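{- For every $n\geq 4$, the poset $\mathcal{S}_n$ is not a lattice.
   Context: All graphs are finite and simple. The chromatic symmetric function of a graph $G$ with vertices $v_1,\dots,v_n$ is $X_G=\sum_{\kappa}x_{\kappa(v_1)}\cdots x_{\kappa(v_n)}$, summed over all proper colorings $\kappa:V(G)\to\{1,2,3,\dots\}$; it is a homogeneous symmetric function of degree $n$ over $\mathbb{Q}$. Let $s_\lambda$ be the Schur symmetric functions; $[s_\lambda]F$ denotes the coefficient of $s_\lambda$ in $F$ expanded in this basis, and $F$ is Schur-positive if $[s_\lambda]F\ge 0$ for all $\lambda$. For connected graphs $G,H$ on $n$ vertices (for which $[s_{(1^n)}]X_G$ and $[s_{(1^n)}]X_H$ are positive), set $$X_s(G,H)=X_G-\frac{[s_{(1^n)}]X_G}{[s_{(1^n)}]X_H}X_H.$$ $\mathcal{S}_n$ is the poset whose elements are the equivalence classes of connected graphs on $n$ vertices under $G\sim H\iff X_G=X_H$, ordered by $G\geq_s H$ if and only if $X_s(G,H)$ is Schur-positive. -}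

module Defs where

open import Algebra.Core using (Op₂)
open import Data.Bool.Base using (Bool; true; false)
import Data.Bool.Properties as Bool
open import Data.Fin.Base as Fin using (Fin; finToFun)
import Data.Fin.Properties as Fin
open import Data.Integer.Base using (+_)
open import Data.List.Base
  using (List; []; _∷_; _++_; map; filter; length; concat; zip; allFin;
         tabulate; replicate; foldr; cartesianProductWith)
import Data.List.Properties as List
open import Data.List.Relation.Unary.All using (All; all?)
open import Data.List.Relation.Unary.Linked using (Linked; linked?)
open import Data.Nat.Base as ℕ using (ℕ; zero; suc)
open import Data.Nat.ListAction using (sum)
import Data.Nat.Properties as ℕ
open import Data.Product.Base using (Σ; ∃; ∃₂; _×_; _,_; proj₁; uncurry)
open import Data.Rational.Base as ℚ using (ℚ; 0ℚ; _/_; Positive; NonNegative)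
import Data.Rational.Properties as ℚ
open import Level using (0ℓ)
open import Relation.Binary.Bundles.Raw using (RawRelation)
open import Relation.Binary.Construct.Closure.ReflexiveTransitive using (Star)
open import Relation.Binary.Lattice.Definitions using (Supremum; Infimum)
open import Relation.Binary.PropositionalEquality using (_≡_; _≢_; _≗_)
open import Relation.Nullary using (Dec; ¬?; _×-dec_; _→-dec_)

record Graph (n : ℕ) : Set where
  field
    adj    : Fin n → Fin n → Bool
    sym    : ∀ u v → adj u v ≡ adj v u
    irrefl : ∀ v → adj v v ≡ false

  Edge : Fin n → Fin n → Set
  Edge u v = adj u v ≡ true

  edge? : ∀ u v → Dec (Edge u v)
  edge? u v = adj u v Bool.≟ true

Connected : ∀ {n} → Graph n → Set
Connected G = ∀ u v → Star (Graph.Edge G) u v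

ConnectedGraph : ℕ → Set
ConnectedGraph n = Σ (Graph n) Connected

-- Power series in x₁, x₂, … over ℚ, given by their coefficients: F α is the
-- coefficient of x₁^α₁ ⋯ x_k^α_k where α = α₁ ∷ … ∷ α_k ∷ [].  Exponent
-- lists may contain zeros and need not be sorted.
Series : Set
Series = List ℕ → ℚ

infixl 6 _⊖_
_⊖_ : Series → Series → Series
(F ⊖ G) α = F α ℚ.- G α

infixr 7 _·_
_·_ : ℚ → Series → Series
(r · F) α = r ℚ.* F α

-- The exponent list of the monomial x_{w₁} x_{w₂} ⋯ .
content : ∀ {k} → List (Fin k) → List ℕ
content {k} w = map (λ i → length (filter (i Fin.≟_) w)) (allFin k)

-- All maps Fin n → Fin k, each listed once.
functions : ∀ n k → List (Fin n → Fin k)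
functions n k = map finToFun (allFin (k ℕ.^ n))

Proper : ∀ {n k} → Graph n → (Fin n → Fin k) → Set
Proper G κ = ∀ u v → Graph.Edge G u v → κ u ≢ κ v

proper? : ∀ {n k} (G : Graph n) (κ : Fin n → Fin k) → Dec (Proper G κ)
proper? G κ =
  Fin.all? λ u → Fin.all? λ v → Graph.edge? G u v →-dec ¬? (κ u Fin.≟ κ v)

-- A colouring contributing to the coefficient of α = α₁ ∷ … ∷ α_k ∷ [] only
-- uses the first k colours, so there are finitely many to count.
X : ∀ {n} → Graph n → Series
X {n} G α = + length (filter good? (functions n (length α))) / 1
  where
  good? : (κ : Fin n → Fin (length α)) →
          Dec (Proper G κ × content (tabulate κ) ≡ α)
  good? κ = proper? G κ ×-dec List.≡-dec ℕ._≟_ (content (tabulate κ)) α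

-- Weakly decreasing lists of positive integers with at most k entries, all
-- of them at most m; each listed once.
boxPartitions : (m k : ℕ) → List (List ℕ)
boxPartitions zero    k       = [] ∷ []
boxPartitions (suc m) zero    = [] ∷ []
boxPartitions (suc m) (suc k) =
  boxPartitions m (suc k) ++ map (suc m ∷_) (boxPartitions (suc m) k)

partitions : ℕ → List (List ℕ)
partitions n = filter (λ p → sum p ℕ.≟ n) (boxPartitions n n)

-- Fillings of the Young diagram with row lengths p by entries in Fin k, as
-- lists of rows; each listed once.
fillings : ∀ k → List ℕ → List (List (List (Fin k)))
fillings k []      = [] ∷ []
fillings k (r ∷ p) =
  cartesianProductWith _∷_ (map tabulate (functions r k)) (fillings k p)

-- The lower row is never longer than the upper one, so zip pairs each of its
-- entries with the entry directly above.
ColumnStrict : ∀ {k} → List (Fin k) → List (Fin k) → Set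
ColumnStrict upper lower = All (uncurry Fin._<_) (zip upper lower)

Semistandard : ∀ {k} → List (List (Fin k)) → Set
Semistandard T = All (Linked Fin._≤_) T × Linked ColumnStrict T

semistandard? : ∀ {k} (T : List (List (Fin k))) → Dec (Semistandard T)
semistandard? T =
  all? (linked? Fin._≤?_) T
  ×-dec linked? (λ r s → all? (λ (i , j) → i Fin.<? j) (zip r s)) T

-- The Schur function: the sum of x^T over semistandard tableaux T of shape p.
schur : List ℕ → Series
schur p α = + length (filter good? (fillings (length α) p)) / 1
  where
  good? : (T : List (List (Fin (length α)))) →
          Dec (Semistandard T × content (concat T) ≡ α)
  good? T = semistandard? T ×-dec List.≡-dec ℕ._≟_ (content (concat T)) α

schurSum : ℕ → (List ℕ → ℚ) → Series
schurSum n c α =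
  foldr ℚ._+_ 0ℚ (map (λ p → c p ℚ.* schur p α) (partitions n))

-- F = Σ_{p ⊢ n} c p · s_p, that is, [s_p] F = c p for every partition p of n.
-- Since the s_p with p ⊢ n form a basis of the homogeneous symmetric functions
-- of degree n, such a c exists for every such F and is unique on partitions
-- of n.
SchurExpansion : ℕ → Series → (List ℕ → ℚ) → Set
SchurExpansion n F c = F ≗ schurSum n c

SchurPositive : ℕ → Series → Set
SchurPositive n F =
  ∃ λ c → SchurExpansion n F c × All (λ p → NonNegative (c p)) (partitions n)

1ⁿ : ℕ → List ℕ
1ⁿ n = replicate n 1

-- a and b are the Schur coefficients of X G and X H.  Positivity of those at
-- (1ⁿ), which holds for all connected graphs, is recorded because the quotient
-- is formed under that condition.
record _≥ₛ_ {n : ℕ} (G H : Graph n) : Set where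
  field
    a b        : List ℕ → ℚ
    expansionG : SchurExpansion n (X G) a
    expansionH : SchurExpansion n (X H) b
    positiveG  : Positive (a (1ⁿ n))
    positiveH  : Positive (b (1ⁿ n))

  ratio : ℚ
  ratio = (a (1ⁿ n) ℚ.÷ b (1ⁿ n))
            {{ℚ.pos⇒nonZero (b (1ⁿ n)) {{positiveH}}}}

  Xₛ : Series
  Xₛ = X G ⊖ ratio · X H

  field
    schurPositive : SchurPositive n Xₛ

-- Equivalence classes are rendered as a setoid: the elements are connected
-- graphs, and the equality is equality of chromatic symmetric functions.
𝒮 : ℕ → RawRelation 0ℓ 0ℓ 0ℓ
𝒮 n = record
  { Carrier = ConnectedGraph n
  ; _≈_     = λ G H → X (proj₁ G) ≗ X (proj₁ H)
  ; _∼_     = λ G H → proj₁ H ≥ₛ proj₁ G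
  }

-- Every pair of elements has a supremum and an infimum.  In a poset these are
-- unique up to _≈_, so this does not depend on the choice of representatives.
IsLattice : RawRelation 0ℓ 0ℓ 0ℓ → Set
IsLattice P = ∃₂ λ (_∨_ _∧_ : Op₂ Carrier) → Supremum _≤_ _∨_ × Infimum _≤_ _∧_
  where open RawRelation P renaming (_∼_ to _≤_)

{-# OPTIONS --safe #-}

-- The complete graph K and the star S have no common lower bound.  If L ≤ K,
-- then X L vanishes at every exponent where X K does, since X K − r X L is
-- Schur-positive and hence has nonnegative coefficients; in particular at
-- (n−1, 1) and (n−2, 2).  If also L ≤ S, then at these two exponents X S agrees
-- with a nonnegative combination of Schur functions, and any s_p containing
-- the monomial (n−1, 1) contains (n−2, 2) too.  But the star has a stable
-- partition of type (n−1, 1) and none of type (n−2, 2).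
module Submission where

open import Data.Bool.Base using (Bool; true; false)
open import Data.Fin.Base as Fin using (Fin; zero; suc; finToFun; funToFin)
open import Data.Fin.Patterns using (0F; 1F)
import Data.Fin.Properties as Fin
open import Data.Integer.Base using (+_)
open import Data.List.Base
  using (List; []; _∷_; _++_; map; filter; length; concat; tabulate; replicate;
         foldr; lookup)
import Data.List.Properties as List
open import Data.List.Membership.Propositional using (_∈_)
open import Data.List.Membership.Propositional.Properties
  using (∈-map⁺; ∈-map⁻; ∈-filter⁺; ∈-filter⁻; ∈-++⁻; ∈-allFin;
         ∈-cartesianProductWith⁺; ∈-cartesianProductWith⁻)
open import Data.List.Relation.Unary.All as All using (All; []; _∷_)
import Data.List.Relation.Unary.All.Properties as All
open import Data.List.Relation.Unary.Any using (here)
open import Data.List.Relation.Unary.Linked using (Linked; []; [-]; _∷_)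
open import Data.Nat.Base as ℕ using (ℕ; zero; suc; _≥_; s≤s; z≤n)
import Data.Nat.Properties as ℕ
open import Data.Product.Base using (∃; _×_; _,_; proj₁; proj₂)
open import Data.Rational.Base as ℚ using (ℚ; 0ℚ; _/_; Positive; NonNegative)
import Data.Rational.Properties as ℚ
open import Data.Sum.Base using (inj₁; inj₂)
open import Function.Base using (_∘_; case_of_)
open import Level using (Level)
open import Relation.Binary.Construct.Closure.ReflexiveTransitive
  using (ε; _◅_)
open import Relation.Binary.PropositionalEquality
open import Relation.Nullary using (¬_; yes; no; ¬?; does; contradiction; _×-dec_)
open import Relation.Unary using (Decidable)
open import Defs

private
  variable
    ℓ p : Level
    A : Set ℓ
    P : A → Set p
    k n : ℕ

-- Vanishing of sums of nonnegative rationals.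

+/1≡0⇒≡0 : ∀ k → + k / 1 ≡ 0ℚ → k ≡ 0
+/1≡0⇒≡0 k eq =
  -- Injectivity of normalisation is cross-multiplied: it yields `k * 1 ≡ 0 * 1`, whose right side
  -- computes to 0.
  trans (sym (ℕ.*-identityʳ k)) (ℚ.normalize-injective-≃ k 0 1 1 eq)

0≤+/1 : ∀ k → 0ℚ ℚ.≤ + k / 1
0≤+/1 k = ℚ.nonNegative⁻¹ (+ k / 1) {{ℚ.normalize-nonNeg k 1}}

0≤* : ∀ x y → NonNegative x → 0ℚ ℚ.≤ y → 0ℚ ℚ.≤ x ℚ.* y
0≤* x y x≥0 y≥0 =
  ℚ.nonNegative⁻¹ _
    {{ℚ.nonNeg*nonNeg⇒nonNeg x {{x≥0}} y {{ℚ.nonNegative y≥0}}}}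

r*x≡0⇒x≡0 : ∀ r {x} → Positive r → r ℚ.* x ≡ 0ℚ → x ≡ 0ℚ
r*x≡0⇒x≡0 r {x} r>0 eq =
  ℚ.≤-antisym
    (ℚ.*-cancelˡ-≤-pos r {{r>0}} (ℚ.≤-reflexive rx≡r0))
    (ℚ.*-cancelˡ-≤-pos r {{r>0}} (ℚ.≤-reflexive (sym rx≡r0)))
  where
  rx≡r0 : r ℚ.* x ≡ r ℚ.* 0ℚ
  rx≡r0 = trans eq (sym (ℚ.*-zeroʳ r))

0≤x∧0≤y∧x+y≡0⇒x≡0 : ∀ {x y} → 0ℚ ℚ.≤ x → 0ℚ ℚ.≤ y → x ℚ.+ y ≡ 0ℚ → x ≡ 0ℚ
0≤x∧0≤y∧x+y≡0⇒x≡0 {x} {y} x≥0 y≥0 eq = ℚ.≤-antisym x≤0 x≥0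
  where
  open ℚ.≤-Reasoning
  x≤0 : x ℚ.≤ 0ℚ
  x≤0 = begin
    x         ≡⟨ ℚ.+-identityʳ x ⟨
    x ℚ.+ 0ℚ  ≤⟨ ℚ.+-monoʳ-≤ x y≥0 ⟩
    x ℚ.+ y   ≡⟨ eq ⟩
    0ℚ        ∎

sumℚ : List ℚ → ℚ
sumℚ = foldr ℚ._+_ 0ℚ

sumℚ-nonNegative : ∀ {xs} → All (0ℚ ℚ.≤_) xs → 0ℚ ℚ.≤ sumℚ xs
sumℚ-nonNegative []           = ℚ.≤-refl
sumℚ-nonNegative (x≥0 ∷ xs≥0) = ℚ.+-mono-≤ x≥0 (sumℚ-nonNegative xs≥0)

sumℚ≡0⇒All≡0 : ∀ {xs} → All (0ℚ ℚ.≤_) xs → sumℚ xs ≡ 0ℚ → All (_≡ 0ℚ) xs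
sumℚ≡0⇒All≡0 []           _  = []
sumℚ≡0⇒All≡0 {x ∷ xs} (x≥0 ∷ xs≥0) eq =
  0≤x∧0≤y∧x+y≡0⇒x≡0 x≥0 s≥0 eq ∷
  sumℚ≡0⇒All≡0 xs≥0
    (0≤x∧0≤y∧x+y≡0⇒x≡0 s≥0 x≥0 (trans (ℚ.+-comm (sumℚ xs) x) eq))
  where
  s≥0 : 0ℚ ℚ.≤ sumℚ xs
  s≥0 = sumℚ-nonNegative xs≥0

All≡0⇒sumℚ≡0 : ∀ {xs} → All (_≡ 0ℚ) xs → sumℚ xs ≡ 0ℚ
All≡0⇒sumℚ≡0 []            = refl
All≡0⇒sumℚ≡0 (refl ∷ xs≡0) = trans (ℚ.+-identityˡ _) (All≡0⇒sumℚ≡0 xs≡0)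

terms-nonNegative : ∀ (c s : A → ℚ) → (∀ x → 0ℚ ℚ.≤ s x) →
                    ∀ {xs} → All (λ x → NonNegative (c x)) xs →
                    All (0ℚ ℚ.≤_) (map (λ x → c x ℚ.* s x) xs)
terms-nonNegative c s s≥0 c≥0 =
  All.map⁺ (All.map (λ {x} c≥0 → 0≤* (c x) (s x) c≥0 (s≥0 x)) c≥0)

-- A sum of nonnegative terms `c x * t x` is zero only if every term is. So each `x` has `c x ≡ 0`
-- or `t x ≡ 0`, and in the second case `s x ≡ 0` as well; either way its term in the other sum
-- vanishes.
combination-vanish :
  ∀ (c s t : A → ℚ) → (∀ x → 0ℚ ℚ.≤ t x) →
  ∀ {xs} → (∀ {x} → x ∈ xs → t x ≡ 0ℚ → s x ≡ 0ℚ) →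
  All (λ x → NonNegative (c x)) xs →
  sumℚ (map (λ x → c x ℚ.* t x) xs) ≡ 0ℚ →
  sumℚ (map (λ x → c x ℚ.* s x) xs) ≡ 0ℚ
combination-vanish c s t t≥0 {xs} t⇒s c≥0 Σct≡0 =
  All≡0⇒sumℚ≡0 (All.map⁺ (All.tabulate term))
  where
  ct≡0 : All (λ x → c x ℚ.* t x ≡ 0ℚ) xs
  ct≡0 = All.map⁻ (sumℚ≡0⇒All≡0 (terms-nonNegative c t t≥0 c≥0) Σct≡0)

  term : ∀ {x} → x ∈ xs → c x ℚ.* s x ≡ 0ℚ
  term {x} x∈ with c x ℚ.≟ 0ℚ
  ... | yes c≡0 = trans (cong (ℚ._* s x) c≡0) (ℚ.*-zeroˡ (s x))
  ... | no  c≢0 = trans (cong (c x ℚ.*_) (t⇒s x∈ t≡0)) (ℚ.*-zeroʳ (c x))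
    where
    c>0 : Positive (c x)
    c>0 = ℚ.nonNeg∧nonZero⇒pos (c x)
            {{All.lookup c≥0 x∈}} {{ℚ.≢-nonZero c≢0}}

    t≡0 : t x ≡ 0ℚ
    t≡0 = r*x≡0⇒x≡0 (c x) c>0 (All.lookup ct≡0 x∈)

-- Chromatic and Schur coefficients as counts.

length-filter≡0 : (P? : Decidable P) {xs : List A} →
                  (∀ {x} → x ∈ xs → ¬ P x) → length (filter P? xs) ≡ 0
length-filter≡0 P? none =
  cong length (List.filter-none P? (All.tabulate none))

length-filter≡0⇒ : (P? : Decidable P) {xs : List A} →
                   length (filter P? xs) ≡ 0 → ∀ {x} → x ∈ xs → ¬ P x
length-filter≡0⇒ P? {xs} eq x∈xs px
  -- The membership proof is abstracted together with the filtered list: an empty list has no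
  -- members, and a nonempty one has nonzero length.
  with filter P? xs | ∈-filter⁺ P? x∈xs px
length-filter≡0⇒ P? () _ _ | _ ∷ _ | _

-- The listed functions are decoded numbers, so without function extensionality `f` is matched only
-- up to pointwise equality.
functions-complete : (f : Fin n → Fin k) →
                     ∃ λ g → g ∈ functions n k × g ≗ f
functions-complete f =
  finToFun (funToFin f) , ∈-map⁺ finToFun (∈-allFin (funToFin f)) ,
  Fin.finToFun-funToFin f

-- The decision procedures local to X and schur cannot be named from outside;
-- colours? and fills? are definitionally equal to them.
colours? : ∀ (G : Graph n) α →
           Decidable λ (κ : Fin n → Fin (length α)) →
             Proper G κ × content (tabulate κ) ≡ α
colours? G α κ =
  proper? G κ ×-dec List.≡-dec ℕ._≟_ (content (tabulate κ)) α

colourings : Graph n → List ℕ → ℕ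
colourings {n} G α = length (filter (colours? G α) (functions n (length α)))

X≡colourings : ∀ (G : Graph n) α → X G α ≡ + colourings G α / 1
X≡colourings G α = refl

X≡0 : ∀ (G : Graph n) α →
      (∀ κ → Proper G κ → content (tabulate κ) ≢ α) → X G α ≡ 0ℚ
X≡0 G α none =
  trans (X≡colourings G α)
    (cong (λ c → + c / 1) {colourings G α} {0}
      (length-filter≡0 (colours? G α) {functions _ (length α)}
        λ {κ} _ (proper , eq) → none κ proper eq))

X≡0⇒ : ∀ (G : Graph n) α → X G α ≡ 0ℚ →
       ∀ κ → Proper G κ → content (tabulate κ) ≢ α
X≡0⇒ G α eq κ proper content≡α =
  case functions-complete κ of λ (g , g∈ , g≗κ) →
    length-filter≡0⇒ (colours? G α)
      (+/1≡0⇒≡0 (colourings G α) (trans (sym (X≡colourings G α)) eq)) g∈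
      -- Properness and content depend only on the values of a colouring, so both pass from `κ` to
      -- its listed copy `g`.
      ( (λ u v e gu≡gv →
           proper u v e (trans (sym (g≗κ u)) (trans gu≡gv (g≗κ v))))
      , trans (cong content (List.tabulate-cong g≗κ)) content≡α )

0≤X : ∀ (G : Graph n) α → 0ℚ ℚ.≤ X G α
0≤X G α = subst (0ℚ ℚ.≤_) (sym (X≡colourings G α)) (0≤+/1 (colourings G α))

-- Membership is literal here: rows are lists, and tabulating pointwise equal functions gives equal
-- lists.
fillings-complete : ∀ (T : List (List (Fin k))) → T ∈ fillings k (map length T)
fillings-complete []      = here refl
fillings-complete {k} (r ∷ T) =
  ∈-cartesianProductWith⁺ _∷_ r∈ (fillings-complete T)
  where
  r∈ : r ∈ map tabulate (functions (length r) k)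
  r∈ = case functions-complete (lookup r) of λ (g , g∈ , g≗) →
    subst (_∈ map tabulate (functions (length r) k))
      (trans (List.tabulate-cong g≗) (List.tabulate-lookup r))
      (∈-map⁺ tabulate g∈)

fillings-shape : ∀ λs {T} → T ∈ fillings k λs → map length T ≡ λs
fillings-shape []       (here refl) = refl
fillings-shape {k} (r ∷ λs) T∈
  with _ , _ , row∈ , T′∈ , refl
         ← ∈-cartesianProductWith⁻ _∷_ (map tabulate (functions r k)) _ T∈
  with f , _ , refl ← ∈-map⁻ tabulate row∈
  = cong₂ _∷_ (List.length-tabulate f) (fillings-shape λs T′∈)

fills? : ∀ α → Decidable λ (T : List (List (Fin (length α)))) →
                 Semistandard T × content (concat T) ≡ α
fills? α T = semistandard? T ×-dec List.≡-dec ℕ._≟_ (content (concat T)) α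

kostka : List ℕ → List ℕ → ℕ
kostka λs α = length (filter (fills? α) (fillings (length α) λs))

schur≡kostka : ∀ λs α → schur λs α ≡ + kostka λs α / 1
schur≡kostka λs α = refl

schur≡0 : ∀ λs α →
          (∀ T → map length T ≡ λs → Semistandard T →
             content {length α} (concat T) ≢ α) →
          schur λs α ≡ 0ℚ
schur≡0 λs α none =
  trans (schur≡kostka λs α)
    (cong (λ c → + c / 1) {kostka λs α} {0}
      (length-filter≡0 (fills? α) {fillings (length α) λs} λ {T} T∈ (ss , eq) →
        none T (fillings-shape λs T∈) ss eq))

schur≡0⇒ : ∀ λs α → schur λs α ≡ 0ℚ →
           ∀ T → map length T ≡ λs → Semistandard T →
           content {length α} (concat T) ≢ α
schur≡0⇒ λs α eq T shape ss content≡α =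
  length-filter≡0⇒ (fills? α)
    (+/1≡0⇒≡0 (kostka λs α) (trans (sym (schur≡kostka λs α)) eq))
    (subst (λ μs → T ∈ fillings (length α) μs) shape (fillings-complete T))
    (ss , content≡α)

0≤schur : ∀ λs α → 0ℚ ℚ.≤ schur λs α
0≤schur λs α = subst (0ℚ ℚ.≤_) (sym (schur≡kostka λs α)) (0≤+/1 (kostka λs α))

-- Schur-positivity and vanishing coefficients.

schurPositive⇒nonNegative : ∀ n {F} → SchurPositive n F → ∀ α → 0ℚ ℚ.≤ F α
schurPositive⇒nonNegative n (c , expansion , c≥0) α =
  subst (0ℚ ℚ.≤_) (sym (expansion α))
    (sumℚ-nonNegative
      (terms-nonNegative c (λ λs → schur λs α) (λ λs → 0≤schur λs α) c≥0))

-- `F β ≡ 0ℚ` kills the coefficient of every Schur function that is nonzero at `β`; by hypothesis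
-- the remaining ones are zero at `α`.
schurPositive-vanish :
  ∀ n {F} α β → (∀ {λs} → λs ∈ partitions n → schur λs β ≡ 0ℚ → schur λs α ≡ 0ℚ) →
  SchurPositive n F → F β ≡ 0ℚ → F α ≡ 0ℚ
schurPositive-vanish n α β β⇒α (c , expansion , c≥0) Fβ≡0 =
  trans (expansion α)
    (combination-vanish c (λ λs → schur λs α) (λ λs → schur λs β)
      (λ λs → 0≤schur λs β) β⇒α c≥0 (trans (sym (expansion β)) Fβ≡0))

ratio-positive : ∀ {G H : Graph n} (G≥H : G ≥ₛ H) → Positive (_≥ₛ_.ratio G≥H)
ratio-positive {n} G≥H =
  ℚ.pos*pos⇒pos (a (1ⁿ n)) {{positiveG}} _ {{ℚ.1/pos⇒pos (b (1ⁿ n)) {{positiveH}}}}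
  where open _≥ₛ_ G≥H

0-x≥0⇒x≤0 : ∀ {x} → 0ℚ ℚ.≤ 0ℚ ℚ.- x → x ℚ.≤ 0ℚ
0-x≥0⇒x≤0 {x} h = begin
  x                    ≡⟨ ℚ.+-identityˡ x ⟨
  0ℚ ℚ.+ x             ≤⟨ ℚ.+-monoˡ-≤ x h ⟩
  (0ℚ ℚ.- x) ℚ.+ x     ≡⟨ ℚ.+-assoc 0ℚ (ℚ.- x) x ⟩
  0ℚ ℚ.+ (ℚ.- x ℚ.+ x) ≡⟨ ℚ.+-identityˡ (ℚ.- x ℚ.+ x) ⟩
  ℚ.- x ℚ.+ x          ≡⟨ ℚ.+-inverseˡ x ⟩
  0ℚ                   ∎
  where open ℚ.≤-Reasoning

0≤0-r*x⇒x≡0 : ∀ r {x} → Positive r → 0ℚ ℚ.≤ x →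
               0ℚ ℚ.≤ 0ℚ ℚ.- r ℚ.* x → x ≡ 0ℚ
0≤0-r*x⇒x≡0 r {x} r>0 x≥0 h =
  r*x≡0⇒x≡0 r r>0
    (ℚ.≤-antisym (0-x≥0⇒x≤0 h) (0≤* r x (ℚ.pos⇒nonNeg r {{r>0}}) x≥0))

-- Where `X G` is zero, the nonnegative coefficient of `Xₛ` is minus a positive multiple of `X H α`,
-- which is itself nonnegative as a count.
≥ₛ-vanish : ∀ {G H : Graph n} → G ≥ₛ H → ∀ α → X G α ≡ 0ℚ → X H α ≡ 0ℚ
≥ₛ-vanish {n} {G} {H} G≥H α XG≡0 =
  0≤0-r*x⇒x≡0 ratio {X H α} (ratio-positive G≥H) (0≤X H α)
    (subst (λ x → 0ℚ ℚ.≤ x ℚ.- ratio ℚ.* X H α) XG≡0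
      (schurPositive⇒nonNegative n schurPositive α))
  where open _≥ₛ_ G≥H

x-r*0≡x : ∀ r {x y} → y ≡ 0ℚ → x ℚ.- r ℚ.* y ≡ x
x-r*0≡x r {x} refl =
  trans (cong (λ z → x ℚ.- z) (ℚ.*-zeroʳ r)) (ℚ.+-identityʳ x)

Xₛ≡X : ∀ {G H : Graph n} (G≥H : G ≥ₛ H) α → X H α ≡ 0ℚ →
       _≥ₛ_.Xₛ G≥H α ≡ X G α
Xₛ≡X {G = G} {H} G≥H α = x-r*0≡x (_≥ₛ_.ratio G≥H) {X G α} {X H α}

-- Words and tableaux in two letters.

count : Fin k → List (Fin k) → ℕ
count i w = length (filter (i Fin.≟_) w)

count-≢ : ∀ (i : Fin k) {w} → All (i ≢_) w → count i w ≡ 0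
count-≢ i i∉w = cong length (List.filter-none (i Fin.≟_) i∉w)

count-≡ : ∀ (i : Fin k) {w} → All (i ≡_) w → count i w ≡ length w
count-≡ i all = cong length (List.filter-all (i Fin.≟_) all)

count-++ : ∀ (i : Fin k) v w → count i (v ++ w) ≡ count i v ℕ.+ count i w
count-++ i v w =
  trans (cong length (List.filter-++ (i Fin.≟_) v w)) (List.length-++ (filter _ v))

count-total : ∀ (w : List (Fin 2)) → length w ≡ count 0F w ℕ.+ count 1F w
count-total []       = refl
count-total (0F ∷ w) = cong suc (count-total w)
count-total (1F ∷ w) =
  trans (cong suc (count-total w)) (sym (ℕ.+-suc (count 0F w) (count 1F w)))

length-content : ∀ {w : List (Fin 2)} {i j} → content w ≡ i ∷ j ∷ [] →
                 length w ≡ i ℕ.+ j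
length-content {w} refl = count-total w

zeros++ : ℕ → List (Fin 2) → List (Fin 2)
zeros++ m w = replicate m 0F ++ w

content-zeros++ : ∀ m {w i j} → content w ≡ i ∷ j ∷ [] →
                  content (zeros++ m w) ≡ m ℕ.+ i ∷ j ∷ []
content-zeros++ zero    eq = eq
content-zeros++ (suc m) eq =
  cong₂ (λ i j → suc i ∷ j ∷ []) (List.∷-injectiveˡ ih)
    (List.∷-injectiveˡ (List.∷-injectiveʳ ih))
  where ih = content-zeros++ m eq

linked-zeros++ : ∀ m {w} → Linked Fin._≤_ w → Linked Fin._≤_ (zeros++ m w)
linked-zeros++ zero               w≤ = w≤
linked-zeros++ (suc zero) {[]}    w≤ = [-]
linked-zeros++ (suc zero) {_ ∷ _} w≤ = z≤n ∷ w≤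
linked-zeros++ (suc (suc m))      w≤ = z≤n ∷ linked-zeros++ (suc m) w≤

length-zeros++ : ∀ m w → length (zeros++ m w) ≡ m ℕ.+ length w
length-zeros++ zero    w = refl
length-zeros++ (suc m) w = cong suc (length-zeros++ m w)

-- A tableau of content (m + 3, 1) has a single row, or a second row
-- consisting of the only 1; either way the last 0 of the first row can be
-- turned into a 1.
lower-last-zero :
  ∀ m (T : List (List (Fin 2))) → All (1 ℕ.≤_) (map length T) →
  Semistandard T → content (concat T) ≡ 3 ℕ.+ m ∷ 1 ∷ [] →
  ∃ λ (U : List (List (Fin 2))) → map length U ≡ map length T × Semistandard U ×
          content (concat U) ≡ 2 ℕ.+ m ∷ 2 ∷ []
lower-last-zero m [] _ _ ()
lower-last-zero m (r ∷ []) _ _ eq =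
  -- The new row is written outright rather than edited from `r`; only the length of `r` matters,
  -- and the content fixes it.
  zeros++ (2 ℕ.+ m) (1F ∷ 1F ∷ []) ∷ [] ,
  cong (_∷ []) length≡ ,
  (linked-zeros++ (2 ℕ.+ m) (ℕ.≤-refl ∷ [-]) ∷ [] , [-]) ,
  trans (cong content (List.++-identityʳ (zeros++ (2 ℕ.+ m) _)))
    (subst (λ i → content (zeros++ (2 ℕ.+ m) (1F ∷ 1F ∷ [])) ≡ i ∷ 2 ∷ [])
       (ℕ.+-identityʳ (2 ℕ.+ m)) (content-zeros++ (2 ℕ.+ m) refl))
  where
  open ≡-Reasoning
  length≡ : length (zeros++ (2 ℕ.+ m) (1F ∷ 1F ∷ [])) ≡ length r
  length≡ = begin
    length (zeros++ (2 ℕ.+ m) (1F ∷ 1F ∷ []))  ≡⟨ length-zeros++ (2 ℕ.+ m) _ ⟩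
    (2 ℕ.+ m) ℕ.+ 2                            ≡⟨ ℕ.+-suc (2 ℕ.+ m) 1 ⟩
    (3 ℕ.+ m) ℕ.+ 1                            ≡⟨ length-content {r ++ []} eq ⟨
    length (r ++ [])                           ≡⟨ cong length (List.++-identityʳ r) ⟩
    length r                                   ∎
lower-last-zero m ((x ∷ r) ∷ (1F ∷ []) ∷ []) _ _ eq =
  zeros++ (2 ℕ.+ m) (1F ∷ []) ∷ (1F ∷ []) ∷ [] ,
  cong (_∷ 1 ∷ []) length≡ ,
  -- The first row still starts with a 0, so the 1 below it keeps its column strict.
  (linked-zeros++ (2 ℕ.+ m) [-] ∷ [-] ∷ [] , (s≤s z≤n ∷ []) ∷ [-]) ,
  trans (cong content (List.++-assoc (replicate (2 ℕ.+ m) 0F) (1F ∷ []) (1F ∷ [])))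
    (subst (λ i → content (zeros++ (2 ℕ.+ m) (1F ∷ 1F ∷ [])) ≡ i ∷ 2 ∷ [])
       (ℕ.+-identityʳ (2 ℕ.+ m)) (content-zeros++ (2 ℕ.+ m) refl))
  where
  open ≡-Reasoning
  length≡ : length (zeros++ (2 ℕ.+ m) (1F ∷ [])) ≡ length (x ∷ r)
  length≡ = ℕ.+-cancelʳ-≡ 1 _ _ (begin
    length (zeros++ (2 ℕ.+ m) (1F ∷ [])) ℕ.+ 1
      ≡⟨ cong (ℕ._+ 1) (length-zeros++ (2 ℕ.+ m) _) ⟩
    (2 ℕ.+ m) ℕ.+ 1 ℕ.+ 1
      ≡⟨ cong (ℕ._+ 1) (ℕ.+-comm (2 ℕ.+ m) 1) ⟩
    (3 ℕ.+ m) ℕ.+ 1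
      ≡⟨ length-content {x ∷ r ++ 1F ∷ []} eq ⟨
    length (x ∷ r ++ 1F ∷ [])
      ≡⟨ List.length-++ (x ∷ r) ⟩
    length (x ∷ r) ℕ.+ 1
      ∎)
-- The other shapes are impossible: nothing lies strictly above a 0, rows cannot decrease, the
-- content allows a single 1, and nothing in two letters fits below a 1. Empty rows are ruled out by
-- the positivity of the row lengths.
lower-last-zero m ((_ ∷ _) ∷ (0F ∷ _) ∷ _) _ (_ , (() ∷ _) ∷ _) _
lower-last-zero m (_ ∷ (1F ∷ 0F ∷ _) ∷ _) _ (_ ∷ (() ∷ _) ∷ _ , _) _
lower-last-zero m (r ∷ (1F ∷ 1F ∷ s) ∷ T) _ _ eq =
  contradiction
    (trans (sym (count-++ 1F r _)) (List.∷-injectiveˡ (List.∷-injectiveʳ eq)))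
    (ℕ.>⇒≢ (ℕ.m≤n⇒m≤o+n (count 1F r) (s≤s (s≤s z≤n))))
lower-last-zero m (_ ∷ (1F ∷ []) ∷ (0F ∷ _) ∷ _) _ (_ , _ ∷ (() ∷ _) ∷ _) _
lower-last-zero m (_ ∷ (1F ∷ []) ∷ (1F ∷ _) ∷ _) _ (_ , _ ∷ (s≤s () ∷ _) ∷ _) _
lower-last-zero m ([] ∷ _ ∷ _) (() ∷ _) _ _
lower-last-zero m (_ ∷ [] ∷ _) (_ ∷ () ∷ _) _ _
lower-last-zero m (_ ∷ _ ∷ [] ∷ _) (_ ∷ _ ∷ () ∷ _) _ _

boxPartitions-positive : ∀ m k {λs} → λs ∈ boxPartitions m k → All (1 ℕ.≤_) λs
boxPartitions-positive zero    k       (here refl) = []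
boxPartitions-positive (suc m) zero    (here refl) = []
boxPartitions-positive (suc m) (suc k) λs∈
  with ∈-++⁻ (boxPartitions m (suc k)) λs∈
... | inj₁ λs∈m = boxPartitions-positive m (suc k) λs∈m
... | inj₂ λs∈map
  with μs , μs∈ , refl ← ∈-map⁻ (suc m ∷_) λs∈map
  = s≤s z≤n ∷ boxPartitions-positive (suc m) k μs∈

partitions-positive : ∀ n {λs} → λs ∈ partitions n → All (1 ℕ.≤_) λs
partitions-positive n λs∈ =
  boxPartitions-positive n n (proj₁ (∈-filter⁻ _ λs∈))

-- By contraposition: a tableau of content (m + 3, 1) would yield one of the same shape and content
-- (m + 2, 2).
schur-vanish : ∀ n m {λs} → λs ∈ partitions n →
               schur λs (2 ℕ.+ m ∷ 2 ∷ []) ≡ 0ℚ →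
               schur λs (3 ℕ.+ m ∷ 1 ∷ []) ≡ 0ℚ
schur-vanish n m {λs} λs∈ s≡0 = schur≡0 λs (3 ℕ.+ m ∷ 1 ∷ []) λ
  { T refl ss eq →
      case lower-last-zero m T (partitions-positive n λs∈) ss eq of
        λ (U , shape , ssU , eqU) →
          schur≡0⇒ λs (2 ℕ.+ m ∷ 2 ∷ []) s≡0 U shape ssU eqU }

-- The complete graph and the star.

complete : ∀ n → Graph n
complete n = record
  { adj    = λ u v → does (¬? (u Fin.≟ v))
  ; sym    = symmetric
  ; irrefl = irreflexive
  }
  where
  symmetric : ∀ (u v : Fin n) → does (¬? (u Fin.≟ v)) ≡ does (¬? (v Fin.≟ u))
  symmetric u v with u Fin.≟ v | v Fin.≟ u
  ... | yes _   | yes _   = refl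
  ... | no  _   | no  _   = refl
  ... | yes u≡v | no  v≢u = contradiction (sym u≡v) v≢u
  ... | no  u≢v | yes v≡u = contradiction (sym v≡u) u≢v

  irreflexive : ∀ (v : Fin n) → does (¬? (v Fin.≟ v)) ≡ false
  irreflexive v with v Fin.≟ v
  ... | yes _   = refl
  ... | no  v≢v = contradiction refl v≢v

≢⇒complete-edge : ∀ {u v} → u ≢ v → Graph.Edge (complete n) u v
≢⇒complete-edge {u = u} {v} u≢v with u Fin.≟ v
... | yes u≡v = contradiction u≡v u≢v
... | no  _   = refl

complete-connected : ∀ n → Connected (complete n)
complete-connected n u v with u Fin.≟ v
... | yes refl = ε
... | no  u≢v  = ≢⇒complete-edge u≢v ◅ ε

-- By pigeonhole, two distinct vertices share a colour, and they are adjacent.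
X-complete≡0 : ∀ n α → length α ℕ.< n → X (complete n) α ≡ 0ℚ
X-complete≡0 n α k<n = X≡0 (complete n) α λ κ proper _ →
  case Fin.pigeonhole k<n κ of λ (i , j , i<j , κi≡κj) →
    proper i j (≢⇒complete-edge (Fin.<⇒≢ i<j)) κi≡κj

star : ∀ n → Graph (suc n)
star n = record { adj = adj ; sym = symmetric ; irrefl = irreflexive }
  where
  adj : Fin (suc n) → Fin (suc n) → Bool
  adj zero    zero    = false
  adj zero    (suc _) = true
  adj (suc _) zero    = true
  adj (suc _) (suc _) = false

  symmetric : ∀ u v → adj u v ≡ adj v u
  symmetric zero    zero    = refl
  symmetric zero    (suc _) = refl
  symmetric (suc _) zero    = refl
  symmetric (suc _) (suc _) = refl

  irreflexive : ∀ v → adj v v ≡ false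
  irreflexive zero    = refl
  irreflexive (suc _) = refl

star-connected : ∀ n → Connected (star n)
star-connected n zero    zero    = ε
star-connected n zero    (suc _) = refl ◅ ε
star-connected n (suc _) zero    = refl ◅ ε
-- Two leaves are joined through the centre.
star-connected n (suc _) (suc _) = _◅_ {j = zero} refl (refl ◅ ε)

-- Every leaf is adjacent to the centre, so none repeats its colour.
star-count-centre : ∀ (κ : Fin (suc n) → Fin k) → Proper (star n) κ →
                    count (κ zero) (tabulate κ) ≡ 1
star-count-centre κ proper =
  trans
    (cong length (List.filter-accept (κ zero Fin.≟_) {xs = tabulate (κ ∘ suc)} refl))
    (cong suc (count-≢ (κ zero) (All.tabulate⁺ λ i → proper zero (suc i) refl)))

X-star≡0 : ∀ n i j → i ≢ 1 → j ≢ 1 → X (star n) (i ∷ j ∷ []) ≡ 0ℚ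
X-star≡0 n i j i≢1 j≢1 = X≡0 (star n) (i ∷ j ∷ []) neither
  where
  neither : ∀ κ → Proper (star n) κ → content (tabulate κ) ≢ i ∷ j ∷ []
  -- Whichever colour the centre has, the exponent of that colour must be 1.
  neither κ proper eq with κ zero | star-count-centre κ proper
  ... | 0F | c≡1 = i≢1 (trans (sym (List.∷-injectiveˡ eq)) c≡1)
  ... | 1F | c≡1 =
    j≢1 (trans (sym (List.∷-injectiveˡ (List.∷-injectiveʳ eq))) c≡1)

-- The witness colours the centre 1 and all `n` leaves 0.
X-star≢0 : ∀ n → X (star n) (n ∷ 1 ∷ []) ≢ 0ℚ
X-star≢0 n X≡0 = X≡0⇒ (star n) (n ∷ 1 ∷ []) X≡0 κ proper
  (cong₂ (λ i j → i ∷ j ∷ [])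
    (trans (count-≡ 0F leaves) (List.length-tabulate {n = n} _))
    (cong suc (count-≢ 1F (All.map (λ { refl () }) leaves))))
  where
  κ : Fin (suc n) → Fin 2
  κ zero    = 1F
  κ (suc _) = 0F

  leaves : All (0F ≡_) (tabulate (κ ∘ suc))
  leaves = All.tabulate⁺ {n = n} λ _ → refl

  proper : Proper (star n) κ
  proper zero    (suc _) _ ()
  proper (suc _) zero    _ ()

-- Absence of a common lower bound.

no-common-lower-bound :
  ∀ α β {G H L : Graph n} →
  (∀ {λs} → λs ∈ partitions n → schur λs β ≡ 0ℚ → schur λs α ≡ 0ℚ) →
  X G α ≡ 0ℚ → X G β ≡ 0ℚ → X H β ≡ 0ℚ → X H α ≢ 0ℚ →
  G ≥ₛ L → ¬ H ≥ₛ L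
no-common-lower-bound {n} α β β⇒α XGα≡0 XGβ≡0 XHβ≡0 XHα≢0 G≥L H≥L = XHα≢0
  -- `X L` vanishes at `α` and `β` because `X G` does, so there the Schur-positive difference `Xₛ`
  -- of `H` and `L` equals `X H`. Its zero at `β` then forces one at `α`.
  (trans (sym (Xₛ≡X H≥L α (≥ₛ-vanish G≥L α XGα≡0)))
    (schurPositive-vanish n α β β⇒α (_≥ₛ_.schurPositive H≥L)
      (trans (Xₛ≡X H≥L β (≥ₛ-vanish G≥L β XGβ≡0)) XHβ≡0)))

corollary4p13 : ∀ (n : ℕ) → n ≥ 4 → ¬ IsLattice (𝒮 n)
corollary4p13 n@(suc (suc (suc (suc m)))) _ (_ , _∧_ , _ , infimum) =
  -- The meet of `K` and `S` would be a common lower bound.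
  no-common-lower-bound α β {proj₁ K} {proj₁ S} {proj₁ (K ∧ S)} (schur-vanish n m)
    (X-complete≡0 n α k<n) (X-complete≡0 n β k<n)
    (X-star≡0 (3 ℕ.+ m) (2 ℕ.+ m) 2 (λ ()) (λ ())) (X-star≢0 (3 ℕ.+ m))
    (proj₁ (infimum K S)) (proj₁ (proj₂ (infimum K S)))
  where
  α β : List ℕ
  -- These are (n - 1, 1) and (n - 2, 2) for n = m + 4. Since n - 2 is at least 2, neither entry of
  -- `β` is 1, as `X-star≡0` requires.
  α = 3 ℕ.+ m ∷ 1 ∷ []
  β = 2 ℕ.+ m ∷ 2 ∷ []

  k<n : 2 ℕ.< n
  k<n = s≤s (s≤s (s≤s z≤n))

  K S : ConnectedGraph n
  K = complete n , complete-connected n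
  S = star (3 ℕ.+ m) , star-connected (3 ℕ.+ m)
corollary4p13 (suc zero) (s≤s ())
corollary4p13 (suc (suc zero)) (s≤s (s≤s ()))
corollary4p13 (suc (suc (suc zero))) (s≤s (s≤s (s≤s ())))
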